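{- Let $M=(S,v)$ be a model for the logic BH3, let $\varphi$ be a well-formed formula, and let $\Gamma_{\mathrm{BH3}}(M,\varphi)$ be the BH3 semantic game. Then: \begin{itemize} \item Verifier has a dominant winning strategy in $\Gamma_{\mathrm{BH3}}(M,\varphi)$ if and only if $\varphi$ is true in $M$ (has value $T$); \item Falsifier has a dominant winning strategy in $\Gamma_{\mathrm{BH3}}(M,\varphi)$ if and only if $\varphi$ is false in $M$ (has value $F$); \item Dominator has a dominant winning strategy in $\Gamma_{\mathrm{BH3}}(M,\varphi)$ if and only if $\varphi$ is nonsense in $M$ (has value $N$). \end{itemize}
   Context: Formulas: $\varphi := p \mid \neg\varphi \mid \varphi\wedge\varphi \mid \varphi\vee\varphi$, with $p$ in a countable set $\mathbf{P}$ of propositional variables (atoms). Logic BH3 (Bochvar--Halld\'en): truth values $T$ (true), $N$ (nonsense), $F$ (false). Negation: $\neg T=F$, $\neg F=T$, $\neg N=N$. For $\wedge$ and $\vee$: if at least one argument is $N$, the value is $N$; on arguments in $\{T,F\}$ they are the classical conjunction and disjunction. A model is $M=(S,v)$, where $S$ is a non-empty domain and $v$ is a valuation assigning truth values to formulas: arbitrary values on atoms, extended to all formulas by these tables. Game $\Gamma_{\mathrm{BH3}}(M,\varphi)$: there are three players, starting in the roles Verifier, Falsifier, Dominator. Rules (given for roles): ($\rho_p$) if $\varphi$ is atomic, the game terminates; Verifier wins if $\varphi$ is true, Falsifier wins if it is false, Dominator wins if it is nonsense. ($\rho_\neg$) if $\varphi=\neg\psi$, Falsifier and Verifier switch roles,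 Dominator keeps his role, and the game continues as $\Gamma_{\mathrm{BH3}}(M,\psi)$. ($\rho_\wedge$) if $\varphi=\chi\wedge\psi$, Falsifier and Dominator choose between $\chi$ and $\psi$ independently and simultaneously. ($\rho_\vee$) if $\varphi=\chi\vee\psi$, Verifier and Dominator choose between $\chi$ and $\psi$ independently and simultaneously. ($\rho_s$) Dominator's strategy strictly dominates Verifier's and Falsifier's (there is no domination between Verifier and Falsifier). Winning strategies: where a player (in the current role) is entitled to choose, the player continues at the component he or she chose, whatever the simultaneous mover chooses; where a player is not entitled to choose, play may continue at either component. A player has a winning strategy if he or she has a system of choices such that every atom that can be reached in this way is a win for that player in the role held there. "Verifier (Falsifier, Dominator) has a winning strategy in $\Gamma_{\mathrm{BH3}}(M,\varphi)$" refers to the player holding that role at the start. A dominant winning strategy is a winning strategy that determines the truth value of $\varphi$ once played; in view of ($\rho_s$): a winning strategy of a player is dominant if no player whose strategies strictly dominate that player's strategies has a winning strategy in the same game. So every winning strategy of Dominator is dominant, and a winning strategy of Verifier or of Falsifier is dominant exactly when Dominator has no winning strategy. -}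

module Defs where

open import Data.Product using (∃; _×_)
open import Function using (id; _∘_)
open import Level using (Level; suc; _⊔_)
open import Relation.Binary.PropositionalEquality using (_≡_)
open import Relation.Nullary using (¬_)

private
  variable
    a ℓ : Level

infix  9 ~_
infixr 7 _∧_ _∧ᵗ_
infixr 6 _∨_ _∨ᵗ_

data Formula (P : Set a) : Set a where
  atom : P → Formula P
  ~_   : Formula P → Formula P
  _∧_  : Formula P → Formula P → Formula P
  _∨_  : Formula P → Formula P → Formula P

data Truth : Set where
  T N F : Truth

~ᵗ_ : Truth → Truth
~ᵗ T = F
~ᵗ N = N
~ᵗ F = T

_∧ᵗ_ : Truth → Truth → Truth
N ∧ᵗ _ = N
T ∧ᵗ N = N
T ∧ᵗ T = T
T ∧ᵗ F = F
F ∧ᵗ N = N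
F ∧ᵗ T = F
F ∧ᵗ F = F

_∨ᵗ_ : Truth → Truth → Truth
N ∨ᵗ _ = N
T ∨ᵗ N = N
T ∨ᵗ T = T
T ∨ᵗ F = T
F ∨ᵗ N = N
F ∨ᵗ T = T
F ∨ᵗ F = F

record Model (ℓ : Level) (P : Set a) : Set (a ⊔ suc ℓ) where
  field
    S         : Set ℓ
    inhabited : S
    v         : P → Truth

value : {P : Set a} → Model ℓ P → Formula P → Truth
value M (atom p) = Model.v M p
value M (~ φ)    = ~ᵗ value M φ
value M (φ ∧ ψ)  = value M φ ∧ᵗ value M ψ
value M (φ ∨ ψ)  = value M φ ∨ᵗ value M ψ

data Role : Set where
  verifier falsifier dominator : Role

-- A player is named by the role he or she holds at the start of the game.
Player : Set
Player = Role

switch : Role → Role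
switch verifier  = falsifier
switch falsifier = verifier
switch dominator = dominator

data Side : Set where
  left right : Side

data Component {P : Set a} : Formula P → Side → Formula P → Set a where
  ∧-left  : ∀ {χ ψ} → Component (χ ∧ ψ) left  χ
  ∧-right : ∀ {χ ψ} → Component (χ ∧ ψ) right ψ
  ∨-left  : ∀ {χ ψ} → Component (χ ∨ ψ) left  χ
  ∨-right : ∀ {χ ψ} → Component (χ ∨ ψ) right ψ

data _ChoosesAt_ {P : Set a} : Role → Formula P → Set a where
  falsifier-∧ : ∀ {χ ψ} → falsifier ChoosesAt (χ ∧ ψ)
  dominator-∧ : ∀ {χ ψ} → dominator ChoosesAt (χ ∧ ψ)
  verifier-∨  : ∀ {χ ψ} → verifier  ChoosesAt (χ ∨ ψ)
  dominator-∨ : ∀ {χ ψ} → dominator ChoosesAt (χ ∨ ψ)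

-- Position φ ψ ρ is the type of histories of the game on φ that lead to an
-- occurrence of ψ at which each player i holds the role ρ i.
data Position {P : Set a} (φ : Formula P) :
              Formula P → (Player → Role) → Set a where
  start     : Position φ φ id
  negation  : ∀ {ψ ρ} → Position φ (~ ψ) ρ → Position φ ψ (switch ∘ ρ)
  component : ∀ {ψ ρ s χ} → Position φ ψ ρ → Component ψ s χ →
              Position φ χ ρ

-- A choice is made at each history, so two occurrences of the same subformula
-- may be treated differently.  It does not see the choice of the other player
-- entitled to move at the same position: those two choices are simultaneous.
record Strategy {P : Set a} (φ : Formula P) (i : Player) : Set a where
  field
    choice : ∀ {ψ ρ} → Position φ ψ ρ → ρ i ChoosesAt ψ → Side

open Strategy public

-- The positions that player i has to reckon with when following σ.  A choice
-- of i is honoured whatever the simultaneous mover chooses; where i is not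
-- entitled to choose, both components count as reachable.
data Reachable {P : Set a} {φ : Formula P} {i : Player} (σ : Strategy φ i) :
               ∀ {ψ ρ} → Position φ ψ ρ → Set a where
  start    : Reachable σ start
  negation : ∀ {ψ ρ} {h : Position φ (~ ψ) ρ} →
             Reachable σ h → Reachable σ (negation h)
  chosen   : ∀ {ψ ρ χ} {h : Position φ ψ ρ} → Reachable σ h →
             (e : ρ i ChoosesAt ψ) (c : Component ψ (choice σ h e) χ) →
             Reachable σ (component h c)
  unchosen : ∀ {ψ ρ s χ} {h : Position φ ψ ρ} → Reachable σ h →
             ¬ (ρ i ChoosesAt ψ) → (c : Component ψ s χ) →
             Reachable σ (component h c)

winner : Truth → Role
winner T = verifier
winner N = dominator
winner F = falsifier

Winning : {P : Set a} (M : Model ℓ P) (φ : Formula P) {i : Player} →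
          Strategy φ i → Set a
Winning M φ {i} σ =
  ∀ p ρ (h : Position φ (atom p) ρ) →
  Reachable σ h → winner (value M (atom p)) ≡ ρ i

HasWinningStrategy : {P : Set a} → Model ℓ P → Formula P → Player → Set a
HasWinningStrategy M φ i = ∃ λ (σ : Strategy φ i) → Winning M φ σ

-- The domination rule is about roles; it transfers to players because the
-- dominator never changes role.
data _StrictlyDominates_ : Player → Player → Set where
  dominator-verifier  : dominator StrictlyDominates verifier
  dominator-falsifier : dominator StrictlyDominates falsifier

Dominant : {P : Set a} (M : Model ℓ P) (φ : Formula P) {i : Player} →
           Strategy φ i → Set a
Dominant M φ {i} σ =
  Winning M φ σ × (∀ j → j StrictlyDominates i → ¬ HasWinningStrategy M φ j)

HasDominantWinningStrategy : {P : Set a} →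
                             Model ℓ P → Formula P → Player → Set a
HasDominantWinningStrategy M φ i = ∃ λ (σ : Strategy φ i) → Dominant M φ σ

{-# OPTIONS --safe #-}
-- For every player at once: if φ has the value won by the role i holds, then i
-- wins by always moving to a component whose value is won by the current role.
-- Conversely, a winning strategy of i forces, by induction from the atoms up,
-- the value of every reachable subformula to be N or the value won by the
-- current role of i.  Dominance excludes N for Verifier and Falsifier, since
-- Dominator wins as soon as φ is nonsense.
module Submission where

open import Defs
open import Data.Nat using (ℕ)
open import Data.Product using (_×_; _,_; proj₁; proj₂)
open import Data.Sum using (_⊎_; inj₁; inj₂; [_,_]; fromInj₂)
open import Function using (id)
open import Function.Bundles using (_↣_; _⇔_; mk⇔)
open import Relation.Binary.Definitions using (DecidableEquality)
open import Relation.Binary.PropositionalEquality using (_≡_; refl; cong)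
open import Relation.Nullary using (¬_; Dec; yes; no; contradiction)

-- Decidability of roles and of the right to choose.

_≟_ : DecidableEquality Role
verifier  ≟ verifier  = yes refl
verifier  ≟ falsifier = no λ ()
verifier  ≟ dominator = no λ ()
falsifier ≟ verifier  = no λ ()
falsifier ≟ falsifier = yes refl
falsifier ≟ dominator = no λ ()
dominator ≟ verifier  = no λ ()
dominator ≟ falsifier = no λ ()
dominator ≟ dominator = yes refl

-- `Reachable` continues differently according to this right; deciding it yields the case split
-- constructively.
choosesAt? : ∀ {a} {P : Set a} (r : Role) (ψ : Formula P) → Dec (r ChoosesAt ψ)
choosesAt? r         (atom p) = no λ ()
choosesAt? r         (~ ψ)    = no λ ()
choosesAt? verifier  (χ ∧ ψ)  = no λ ()
choosesAt? falsifier (χ ∧ ψ)  = yes falsifier-∧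
choosesAt? dominator (χ ∧ ψ)  = yes dominator-∧
choosesAt? verifier  (χ ∨ ψ)  = yes verifier-∨
choosesAt? falsifier (χ ∨ ψ)  = no λ ()
choosesAt? dominator (χ ∨ ψ)  = yes dominator-∨

winner-injective : ∀ {s t} → winner s ≡ winner t → s ≡ t
winner-injective {T} {T} refl = refl
winner-injective {N} {N} refl = refl
winner-injective {F} {F} refl = refl

-- The type of `chosen` mentions the choice itself. Taking its value through an equation lets a
-- proof split on the choice and then supply a concrete component.
reached : ∀ {a} {P : Set a} {φ ψ χ : Formula P} {i ρ s} {σ : Strategy φ i}
          {h : Position φ ψ ρ} → Reachable σ h →
          (e : ρ i ChoosesAt ψ) → choice σ h e ≡ s → (c : Component ψ s χ) →
          Reachable σ (component h c)
reached re e refl c = chosen re e c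

-- Truth tables read from a compound down to its components.

winner-~ᵗ : ∀ t {r} → winner (~ᵗ t) ≡ r → winner t ≡ switch r
winner-~ᵗ T refl = refl
winner-~ᵗ N refl = refl
winner-~ᵗ F refl = refl

∧ᵗ-true : ∀ s t → winner (s ∧ᵗ t) ≡ verifier →
          winner s ≡ verifier × winner t ≡ verifier
∧ᵗ-true T T refl = refl , refl
∧ᵗ-true F T ()
∧ᵗ-true F F ()

∧ᵗ-false : ∀ s t → winner (s ∧ᵗ t) ≡ falsifier →
           winner s ≡ falsifier ⊎ winner t ≡ falsifier
∧ᵗ-false T F refl = inj₂ refl
∧ᵗ-false F t eq   = inj₁ refl

∧ᵗ-nonsense : ∀ s t → winner (s ∧ᵗ t) ≡ dominator →
              winner s ≡ dominator ⊎ winner t ≡ dominator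
∧ᵗ-nonsense N t eq   = inj₁ refl
∧ᵗ-nonsense T N refl = inj₂ refl
∧ᵗ-nonsense F N refl = inj₂ refl

∨ᵗ-true : ∀ s t → winner (s ∨ᵗ t) ≡ verifier →
          winner s ≡ verifier ⊎ winner t ≡ verifier
∨ᵗ-true T t eq   = inj₁ refl
∨ᵗ-true F T refl = inj₂ refl

∨ᵗ-false : ∀ s t → winner (s ∨ᵗ t) ≡ falsifier →
           winner s ≡ falsifier × winner t ≡ falsifier
∨ᵗ-false F F refl = refl , refl
∨ᵗ-false T T ()
∨ᵗ-false T F ()

∨ᵗ-nonsense : ∀ s t → winner (s ∨ᵗ t) ≡ dominator →
              winner s ≡ dominator ⊎ winner t ≡ dominator
∨ᵗ-nonsense N t eq   = inj₁ refl
∨ᵗ-nonsense T N refl = inj₂ refl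
∨ᵗ-nonsense F N refl = inj₂ refl

-- Truth tables read from the components up to a compound.

NonsenseOrWon : Role → Truth → Set
NonsenseOrWon r t = t ≡ N ⊎ winner t ≡ r

~ᵗ-nonsenseOrWon : ∀ r t → NonsenseOrWon (switch r) t → NonsenseOrWon r (~ᵗ t)
~ᵗ-nonsenseOrWon r         N _           = inj₁ refl
~ᵗ-nonsenseOrWon verifier  F (inj₂ refl) = inj₂ refl
~ᵗ-nonsenseOrWon falsifier T (inj₂ refl) = inj₂ refl

∧ᵗ-nonsenseʳ : ∀ s → s ∧ᵗ N ≡ N
∧ᵗ-nonsenseʳ T = refl
∧ᵗ-nonsenseʳ N = refl
∧ᵗ-nonsenseʳ F = refl

∨ᵗ-nonsenseʳ : ∀ s → s ∨ᵗ N ≡ N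
∨ᵗ-nonsenseʳ T = refl
∨ᵗ-nonsenseʳ N = refl
∨ᵗ-nonsenseʳ F = refl

∧ᵗ-falseˡ : ∀ t → NonsenseOrWon falsifier (F ∧ᵗ t)
∧ᵗ-falseˡ T = inj₂ refl
∧ᵗ-falseˡ N = inj₁ refl
∧ᵗ-falseˡ F = inj₂ refl

∧ᵗ-falseʳ : ∀ s → NonsenseOrWon falsifier (s ∧ᵗ F)
∧ᵗ-falseʳ T = inj₂ refl
∧ᵗ-falseʳ N = inj₁ refl
∧ᵗ-falseʳ F = inj₂ refl

∨ᵗ-trueˡ : ∀ t → NonsenseOrWon verifier (T ∨ᵗ t)
∨ᵗ-trueˡ T = inj₂ refl
∨ᵗ-trueˡ N = inj₁ refl
∨ᵗ-trueˡ F = inj₂ refl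

∨ᵗ-trueʳ : ∀ s → NonsenseOrWon verifier (s ∨ᵗ T)
∨ᵗ-trueʳ T = inj₂ refl
∨ᵗ-trueʳ N = inj₁ refl
∨ᵗ-trueʳ F = inj₂ refl

-- Nothing is known about the component not chosen: it may be `N` and infect the conjunction, which
-- is why the invariant must admit `N`. Otherwise a single `F` settles the value for Falsifier. For
-- Dominator both alternatives already mean `N`.
∧ᵗ-chosenˡ : ∀ {a} {P : Set a} {χ ψ : Formula P} {r} → r ChoosesAt (χ ∧ ψ) →
             ∀ s t → NonsenseOrWon r s → NonsenseOrWon r (s ∧ᵗ t)
∧ᵗ-chosenˡ _           N t _           = inj₁ refl
∧ᵗ-chosenˡ falsifier-∧ F t (inj₂ refl) = ∧ᵗ-falseˡ t
∧ᵗ-chosenˡ falsifier-∧ T t (inj₂ ())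
∧ᵗ-chosenˡ dominator-∧ T t (inj₂ ())

∧ᵗ-chosenʳ : ∀ {a} {P : Set a} {χ ψ : Formula P} {r} → r ChoosesAt (χ ∧ ψ) →
             ∀ s t → NonsenseOrWon r t → NonsenseOrWon r (s ∧ᵗ t)
∧ᵗ-chosenʳ _           s N _           = inj₁ (∧ᵗ-nonsenseʳ s)
∧ᵗ-chosenʳ falsifier-∧ s F (inj₂ refl) = ∧ᵗ-falseʳ s
∧ᵗ-chosenʳ falsifier-∧ s T (inj₂ ())
∧ᵗ-chosenʳ dominator-∧ s T (inj₂ ())

∨ᵗ-chosenˡ : ∀ {a} {P : Set a} {χ ψ : Formula P} {r} → r ChoosesAt (χ ∨ ψ) →
             ∀ s t → NonsenseOrWon r s → NonsenseOrWon r (s ∨ᵗ t)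
∨ᵗ-chosenˡ _           N t _           = inj₁ refl
∨ᵗ-chosenˡ verifier-∨  T t (inj₂ refl) = ∨ᵗ-trueˡ t
∨ᵗ-chosenˡ verifier-∨  F t (inj₂ ())
∨ᵗ-chosenˡ dominator-∨ F t (inj₂ ())

∨ᵗ-chosenʳ : ∀ {a} {P : Set a} {χ ψ : Formula P} {r} → r ChoosesAt (χ ∨ ψ) →
             ∀ s t → NonsenseOrWon r t → NonsenseOrWon r (s ∨ᵗ t)
∨ᵗ-chosenʳ _           s N _           = inj₁ (∨ᵗ-nonsenseʳ s)
∨ᵗ-chosenʳ verifier-∨  s T (inj₂ refl) = ∨ᵗ-trueʳ s
∨ᵗ-chosenʳ verifier-∨  s F (inj₂ ())
∨ᵗ-chosenʳ dominator-∨ s F (inj₂ ())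

-- Apart from `N`, two values won by the same role coincide, and `∧ᵗ` is idempotent.
∧ᵗ-both : ∀ r s t → NonsenseOrWon r s → NonsenseOrWon r t →
          NonsenseOrWon r (s ∧ᵗ t)
∧ᵗ-both r N t _           _           = inj₁ refl
∧ᵗ-both r s N _           _           = inj₁ (∧ᵗ-nonsenseʳ s)
∧ᵗ-both _ T T (inj₂ refl) (inj₂ refl) = inj₂ refl
∧ᵗ-both _ F F (inj₂ refl) (inj₂ refl) = inj₂ refl
∧ᵗ-both _ T F (inj₂ refl) (inj₂ ())
∧ᵗ-both _ F T (inj₂ refl) (inj₂ ())

∨ᵗ-both : ∀ r s t → NonsenseOrWon r s → NonsenseOrWon r t →
          NonsenseOrWon r (s ∨ᵗ t)
∨ᵗ-both r N t _           _           = inj₁ refl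
∨ᵗ-both r s N _           _           = inj₁ (∨ᵗ-nonsenseʳ s)
∨ᵗ-both _ T T (inj₂ refl) (inj₂ refl) = inj₂ refl
∨ᵗ-both _ F F (inj₂ refl) (inj₂ refl) = inj₂ refl
∨ᵗ-both _ T F (inj₂ refl) (inj₂ ())
∨ᵗ-both _ F T (inj₂ refl) (inj₂ ())

-- Strategies and reachable positions in a fixed model.

module _ {a ℓ} {P : Set a} (M : Model ℓ P) where

  Won : Role → Formula P → Set
  Won r ψ = winner (value M ψ) ≡ r

  NonsenseOrWonAt : Role → Formula P → Set
  NonsenseOrWonAt r ψ = NonsenseOrWon r (value M ψ)

  -- The side depends on the subformula and the current role only, not on the history. `right` is a
  -- default, taken without testing the right component.
  bestSide : ∀ {r ψ} → r ChoosesAt ψ → Side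
  bestSide {r} {χ ∧ _} _ with winner (value M χ) ≟ r
  ... | yes _ = left
  ... | no  _ = right
  bestSide {r} {χ ∨ _} _ with winner (value M χ) ≟ r
  ... | yes _ = left
  ... | no  _ = right

  won-somewhere-∧ : ∀ {r χ ψ} → r ChoosesAt (χ ∧ ψ) → Won r (χ ∧ ψ) →
                    Won r χ ⊎ Won r ψ
  won-somewhere-∧ falsifier-∧ = ∧ᵗ-false _ _
  won-somewhere-∧ dominator-∧ = ∧ᵗ-nonsense _ _

  won-somewhere-∨ : ∀ {r χ ψ} → r ChoosesAt (χ ∨ ψ) → Won r (χ ∨ ψ) →
                    Won r χ ⊎ Won r ψ
  won-somewhere-∨ verifier-∨  = ∨ᵗ-true _ _
  won-somewhere-∨ dominator-∨ = ∨ᵗ-nonsense _ _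

  won-bestSide : ∀ {r ψ χ} (e : r ChoosesAt ψ) → Component ψ (bestSide e) χ →
                 Won r ψ → Won r χ
  -- Repeating the test of `bestSide` makes the side in the type of `c` compute. If the left
  -- component fails the test, the right one must be won, which justifies the default.
  won-bestSide {r} {χ ∧ _} e c w with winner (value M χ) ≟ r | c
  ... | yes wχ | ∧-left  = wχ
  ... | no ¬wχ | ∧-right = fromInj₂ (λ wχ → contradiction wχ ¬wχ)
                                    (won-somewhere-∧ e w)
  won-bestSide {r} {χ ∨ _} e c w with winner (value M χ) ≟ r | c
  ... | yes wχ | ∨-left  = wχ
  ... | no ¬wχ | ∨-right = fromInj₂ (λ wχ → contradiction wχ ¬wχ)
                                    (won-somewhere-∨ e w)

  -- A role without a choice is Verifier at a conjunction or Falsifier at a disjunction, and there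
  -- its winning value requires the same value of both components.
  won-unchosen : ∀ {r ψ s χ} → ¬ (r ChoosesAt ψ) → Component ψ s χ →
                 Won r ψ → Won r χ
  won-unchosen {verifier}  ¬e ∧-left  w = proj₁ (∧ᵗ-true _ _ w)
  won-unchosen {verifier}  ¬e ∧-right w = proj₂ (∧ᵗ-true _ _ w)
  won-unchosen {falsifier} ¬e ∨-left  w = proj₁ (∨ᵗ-false _ _ w)
  won-unchosen {falsifier} ¬e ∨-right w = proj₂ (∨ᵗ-false _ _ w)
  won-unchosen {falsifier} ¬e ∧-left  w = contradiction falsifier-∧ ¬e
  won-unchosen {falsifier} ¬e ∧-right w = contradiction falsifier-∧ ¬e
  won-unchosen {verifier}  ¬e ∨-left  w = contradiction verifier-∨ ¬e
  won-unchosen {verifier}  ¬e ∨-right w = contradiction verifier-∨ ¬e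
  won-unchosen {dominator} ¬e ∧-left  w = contradiction dominator-∧ ¬e
  won-unchosen {dominator} ¬e ∧-right w = contradiction dominator-∧ ¬e
  won-unchosen {dominator} ¬e ∨-left  w = contradiction dominator-∨ ¬e
  won-unchosen {dominator} ¬e ∨-right w = contradiction dominator-∨ ¬e

  module _ {φ : Formula P} {i : Player} where

    bestStrategy : Strategy φ i
    bestStrategy = record { choice = λ _ → bestSide }

    won-reachable : Won i φ → ∀ {ψ ρ} {h : Position φ ψ ρ} →
                    Reachable bestStrategy h → Won (ρ i) ψ
    won-reachable w start              = w
    won-reachable w (negation re)      = winner-~ᵗ _ (won-reachable w re)
    won-reachable w (chosen re e c)    = won-bestSide e c (won-reachable w re)
    won-reachable w (unchosen re ¬e c) = won-unchosen ¬e c (won-reachable w re)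

    hasWinningStrategy : Won i φ → HasWinningStrategy M φ i
    -- At an atom the invariant is literally the winning condition.
    hasWinningStrategy w = bestStrategy , λ _ _ _ → won-reachable w

    -- Winning says something at atoms only, so the induction is on `ψ`. It ranges over all
    -- histories `h`, since both the history and the role change on passing to a subformula.
    nonsenseOrWon-reachable :
      (σ : Strategy φ i) → Winning M φ σ →
      ∀ ψ {ρ} (h : Position φ ψ ρ) → Reachable σ h → NonsenseOrWonAt (ρ i) ψ
    nonsenseOrWon-reachable σ win = go
      where
      go : ∀ ψ {ρ} (h : Position φ ψ ρ) → Reachable σ h →
           NonsenseOrWonAt (ρ i) ψ
      go (atom p) h re = inj₂ (win p _ h re)
      go (~ ψ) {ρ} h re =
        ~ᵗ-nonsenseOrWon (ρ i) _ (go ψ (negation h) (negation re))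
      go (χ ∧ ψ) {ρ} h re with choosesAt? (ρ i) (χ ∧ ψ)
      ... | no ¬e = ∧ᵗ-both (ρ i) _ _
        (go χ _ (unchosen re ¬e ∧-left)) (go ψ _ (unchosen re ¬e ∧-right))
      -- Only the chosen component is known to be reachable, so there is a single induction
      -- hypothesis.
      ... | yes e with choice σ h e in eq
      ...   | left  = ∧ᵗ-chosenˡ e _ _ (go χ _ (reached re e eq ∧-left))
      ...   | right = ∧ᵗ-chosenʳ e _ _ (go ψ _ (reached re e eq ∧-right))
      go (χ ∨ ψ) {ρ} h re with choosesAt? (ρ i) (χ ∨ ψ)
      ... | no ¬e = ∨ᵗ-both (ρ i) _ _
        (go χ _ (unchosen re ¬e ∨-left)) (go ψ _ (unchosen re ¬e ∨-right))
      ... | yes e with choice σ h e in eq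
      ...   | left  = ∨ᵗ-chosenˡ e _ _ (go χ _ (reached re e eq ∨-left))
      ...   | right = ∨ᵗ-chosenʳ e _ _ (go ψ _ (reached re e eq ∨-right))

    nonsenseOrWon : HasWinningStrategy M φ i → NonsenseOrWonAt i φ
    nonsenseOrWon (σ , win) = nonsenseOrWon-reachable σ win φ start start

theorem3p5 : ∀ {a ℓ} {P : Set a} → P ↣ ℕ → (M : Model ℓ P) (φ : Formula P) →
    (HasDominantWinningStrategy M φ verifier ⇔ value M φ ≡ T)
    × (HasDominantWinningStrategy M φ falsifier ⇔ value M φ ≡ F)
    × (HasDominantWinningStrategy M φ dominator ⇔ value M φ ≡ N)
theorem3p5 _ M φ =
    mk⇔ (λ (σ , win , dom) → winner-injective
           (fromInj₂ (excluded (dom dominator dominator-verifier))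
                     (nonsenseOrWon M (σ , win))))
        -- Only Dominator could spoil dominance, but neither `T ≡ N` nor `winner T ≡ dominator`
        -- holds.
        (λ eq → dominant eq λ where
           _ dominator-verifier (inj₁ ())
           _ dominator-verifier (inj₂ ()))
  , mk⇔ (λ (σ , win , dom) → winner-injective
           (fromInj₂ (excluded (dom dominator dominator-falsifier))
                     (nonsenseOrWon M (σ , win))))
        (λ eq → dominant eq λ where
           _ dominator-falsifier (inj₁ ())
           _ dominator-falsifier (inj₂ ()))
  , mk⇔ (λ (σ , win , _) →
           -- For Dominator the two alternatives of the invariant agree.
           [ id , winner-injective ] (nonsenseOrWon M (σ , win)))
        (λ eq → dominant eq λ where _ ())
  where
  excluded : ∀ {A : Set} → ¬ HasWinningStrategy M φ dominator →
             value M φ ≡ N → A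
  excluded ¬dom eq = contradiction (hasWinningStrategy M (cong winner eq)) ¬dom

  -- Naming the player `winner t` treats the three values uniformly: once `t` is the value of `φ`,
  -- being won is `refl`, and rivals are refuted by the invariant at `t`.
  dominant : ∀ {t} → value M φ ≡ t →
             (∀ j → j StrictlyDominates winner t → ¬ NonsenseOrWon j t) →
             HasDominantWinningStrategy M φ (winner t)
  dominant refl loses =
    let σ , win = hasWinningStrategy M refl
    in σ , win , λ j dom has → loses j dom (nonsenseOrWon M has)
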